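{- Let $G$ be a connected planar graph. Then there are co-bipartite graphs $G_1,G_2,G_3,G_4$, a unit interval graph $G_5$, and a chordal graph $G_6$ such that $G=\bigcap_{i=1}^6 G_i$.
   Context: Graphs are finite, simple and undirected. $G=\bigcap_{i=1}^d G_i$ means that $V(G_i)=V(G)$ for all $i$ and $E(G)=\bigcap_{i=1}^d E(G_i)$. A co-bipartite graph is the complement of a bipartite graph. A unit interval graph is the intersection graph of a family of unit-length intervals on the real line (vertices correspond to intervals, two distinct vertices being adjacent iff their intervals intersect). A graph is chordal if it has no induced (chordless) cycle of length at least four. -}

module Defs where

open import Data.Bool.Base using (Bool; false; T; not; _∧_)
open import Data.Fin.Base using (Fin; toℕ)
open import Data.Fin.Properties using (_≟_)
open import Data.Nat.Base using (ℕ; suc; _+_; _*_)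
open import Data.Nat.DivMod using (_mod_)
open import Data.Nat.GeneralisedArithmetic using (iterate)
open import Data.Product.Base using (Σ-syntax; ∃-syntax; _×_)
open import Data.Rational.Base as ℚ using (ℚ; 1ℚ)
open import Data.Sum.Base using (_⊎_)
open import Function.Base using (_on_)
open import Function.Bundles using (_⇔_)
open import Function.Definitions using (Injective; Surjective)
open import Level using (0ℓ)
open import Relation.Binary.Core using (Rel)
open import Relation.Binary.Construct.Closure.ReflexiveTransitive using (Star)
open import Relation.Binary.PropositionalEquality
  using (_≡_; _≢_; refl; sym; cong; cong₂; subst)
open import Relation.Nullary using (¬_; yes; no; contradiction)
open import Relation.Nullary.Decidable using (⌊_⌋)

-- Finite simple undirected graphs with vertex set Fin n.
record Graph (n : ℕ) : Set where
  field
    adj         : Fin n → Fin n → Bool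
    adj-sym     : ∀ u v → adj u v ≡ adj v u
    adj-irrefl  : ∀ v → adj v v ≡ false

  Adj : Rel (Fin n) 0ℓ
  Adj u v = T (adj u v)

open Graph public

private
  variable
    n : ℕ

Connected : Graph n → Set
Connected G = ∀ u v → Star (Adj G) u v

-- IsIntersection G H : G = ⋂ᵢ H i, all graphs having the same vertex set.
IsIntersection : ∀ {d} → Graph n → (Fin d → Graph n) → Set
IsIntersection G H = ∀ u v → Adj G u v ⇔ (∀ i → Adj (H i) u v)

complement : Graph n → Graph n
complement {n} G = record
  { adj        = co
  ; adj-sym    = λ u v → cong₂ _∧_ (cong not (≟-sym u v)) (cong not (adj-sym G u v))
  ; adj-irrefl = co-irrefl
  }
  where
  co : Fin n → Fin n → Bool
  co u v = not ⌊ u ≟ v ⌋ ∧ not (adj G u v)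

  ≟-sym : ∀ (u v : Fin n) → ⌊ u ≟ v ⌋ ≡ ⌊ v ≟ u ⌋
  ≟-sym u v with u ≟ v | v ≟ u
  ... | yes _   | yes _   = refl
  ... | no _    | no _    = refl
  ... | yes u≡v | no v≢u  = contradiction (sym u≡v) v≢u
  ... | no u≢v  | yes v≡u = contradiction (sym v≡u) u≢v

  co-irrefl : ∀ v → co v v ≡ false
  co-irrefl v with v ≟ v
  ... | yes _  = refl
  ... | no v≢v = contradiction refl v≢v

Bipartite : Graph n → Set
Bipartite {n} G =
  Σ[ side ∈ (Fin n → Bool) ] (∀ u v → Adj G u v → side u ≢ side v)

CoBipartite : Graph n → Set
CoBipartite {n} G =
  Σ[ B ∈ Graph n ] Bipartite B × (∀ u v → adj G u v ≡ adj (complement B) u v)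

-- Membership in the closed unit interval [ a , a + 1 ].
_∈[_,+1] : ℚ → ℚ → Set
p ∈[ a ,+1] = (a ℚ.≤ p) × (p ℚ.≤ a ℚ.+ 1ℚ)

-- Rational endpoints lose no generality for a finite family of intervals.
UnitInterval : Graph n → Set
UnitInterval {n} G =
  Σ[ left ∈ (Fin n → ℚ) ]
    (∀ u v → u ≢ v → Adj G u v ⇔ (∃[ p ] p ∈[ left u ,+1] × p ∈[ left v ,+1]))

-- i and j are consecutive on the cycle 0, 1, …, m, 0.
Consecutive : ∀ {m} → Rel (Fin (suc m)) 0ℓ
Consecutive {m} i j =
  (j ≡ suc (toℕ i) mod suc m) ⊎ (i ≡ suc (toℕ j) mod suc m)

InducedCycle : Graph n → ℕ → Set
InducedCycle {n} G m =
  Σ[ c ∈ (Fin (suc m) → Fin n) ]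
    Injective _≡_ _≡_ c × (∀ i j → Adj G (c i) (c j) ⇔ Consecutive i j)

-- The cycle indexed by 3 + k has 4 + k vertices.
Chordal : Graph n → Set
Chordal G = ∀ k → ¬ InducedCycle G (3 + k)

-- Planarity is expressed through combinatorial embeddings: a rotation system
-- lists the neighbours of each vertex in cyclic order, and it describes an
-- embedding in the plane (equivalently, the sphere) exactly when its faces
-- satisfy Euler's formula.

record Dart (G : Graph n) : Set where
  constructor dart
  field
    tail head : Fin n
    adjacent  : Adj G tail head

open Dart public

-- next v u is the neighbour following u around v; its values at
-- non-neighbours u of v are irrelevant.  By finiteness, `closed` and `cyclic`
-- make next v a single cyclic permutation of the neighbours of v.
record Rotation (G : Graph n) : Set where
  field
    next   : Fin n → Fin n → Fin n
    closed : ∀ v u → Adj G v u → Adj G v (next v u)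
    cyclic : ∀ v u w → Adj G v u → Adj G v w → ∃[ k ] iterate (next v) u k ≡ w

open Rotation public

module _ {G : Graph n} where

  faceStep : Rotation G → Dart G → Dart G
  faceStep R (dart u v uv) =
    dart v (next R v u) (closed R v u (subst T (adj-sym G u v) uv))

  SameVertex SameEdge SameComponent : Rel (Dart G) 0ℓ
  SameVertex = _≡_ on tail
  SameEdge d e = (tail d ≡ tail e × head d ≡ head e)
               ⊎ (tail d ≡ head e × head d ≡ tail e)
  SameComponent = Star (Adj G) on tail

  -- The faces are the orbits of the permutation faceStep R.
  SameFace : Rotation G → Rel (Dart G) 0ℓ
  SameFace R d e = ∃[ k ] iterate (faceStep R) d k ≡ e

-- The equivalence relation _≈_ has exactly k classes.
HasClasses : {A : Set} → Rel A 0ℓ → ℕ → Set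
HasClasses {A} _≈_ k =
  Σ[ class ∈ (A → Fin k) ]
    Surjective _≡_ _≡_ class × (∀ x y → class x ≡ class y ⇔ (x ≈ y))

-- Every component with an edge must satisfy V - E + F = 2.  Summing over these
-- components gives the formula below: each component has V - E + F ≤ 2, so the
-- sum is attained only if all are.  Isolated vertices carry no darts, hence
-- are not counted on either side.
record PlanarEmbedding (G : Graph n) : Set where
  field
    rotation        : Rotation G
    #V #E #F #C     : ℕ
    vertices        : HasClasses (SameVertex {G = G}) #V
    edges           : HasClasses (SameEdge {G = G}) #E
    faces           : HasClasses (SameFace rotation) #F
    components      : HasClasses (SameComponent {G = G}) #C
    euler           : #V + #F ≡ #E + 2 * #C

Planar : Graph n → Set
Planar = PlanarEmbedding

{-# OPTIONS --safe #-}

-- Let T be a breadth-first spanning tree of G.  By Euler's formula the edges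
-- outside T are dual to a spanning tree of the faces; cutting each face open at
-- the dart leading to its parent face turns this into a tree on all darts.  Give
-- each dart d three corners (its two ends and the head of the cutting dart of its
-- face) and let its bag consist of the T-ancestors of these corners.  The bags
-- containing a fixed vertex form a subtree, so the graph H joining vertices that
-- share a bag is chordal and contains G.  A bag meets three consecutive levels
-- of T in at most nine vertices; hence, with G₅ joining vertices whose levels
-- differ by at most one, H ∩ G₅ is 16-colourable by a greedy colouring.  The
-- edges of H ∩ G₅ outside G are then removed by four bipartite graphs, one for
-- each bit of the colour.

module Submission where

open import Defs
open import Data.Bool.Base using (T; true; false)
open import Data.Bool.Properties using (T?; T-irrelevant)
open import Data.Empty using (⊥)
open import Data.Fin.Base
  using (Fin; zero; suc; toℕ; fromℕ; inject₁; splitAt; join; punchOut; finToFun; funToFin;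
    combine)
open import Data.Fin.Patterns using (0F; 1F; 2F; 3F; 4F; 5F)
open import Data.Fin.Properties
  using (_≟_; any?; 2↔Bool; funToFin-finToFin; toℕ-injective; toℕ-fromℕ<; toℕ-fromℕ;
    toℕ-inject₁; toℕ<n; injective⇒≤; punchOut-injective; join-splitAt; suc-injective)
open import Data.Integer.Base as ℤ using (+_)
import Data.Integer.Properties as ℤ
open import Data.List.Base as List using (List; _++_; length; map)
open import Data.List.Membership.DecPropositional using (_∈?_)
open import Data.List.Membership.Propositional using (_∈_; _∉_)
open import Data.List.Membership.Propositional.Properties using (∈-map⁺; ∈-++⁺ˡ; ∈-++⁺ʳ)
import Data.List.Membership.Setoid.Properties as Membership
open import Data.List.Properties using (length-map)
open import Data.List.Relation.Unary.Any using (index; here; there)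
open import Data.Nat.Base using (ℕ; zero; suc; _+_; _*_; _∸_; _≤_; _<_; z≤n; s≤s)
open import Data.Nat.DivMod using (_%_; _mod_; m<n⇒m%n≡m; n%n≡0)
open import Data.Nat.GeneralisedArithmetic using (iterate; iterate-is-fold)
open import Data.Nat.Properties hiding (_≟_; suc-injective)
import Data.Nat.Properties as ℕ
open import Data.Product.Base using (∃-syntax; Σ-syntax; _×_; _,_; proj₁; proj₂; swap)
open import Data.Rational.Base as ℚ using (ℚ; 1ℚ)
open import Data.Rational.Literals using (fromℤ)
import Data.Rational.Properties as ℚ
open import Data.Rational.Unnormalised.Base as ℚᵘ using (mkℚᵘ)
import Data.Rational.Unnormalised.Properties as ℚᵘ
open import Data.Sum.Base using (_⊎_; inj₁; inj₂)
open import Data.Vec.Functional using (_∷_; [])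
open import Function.Base using (_∘_)
open import Function.Bundles using (_⇔_; mk⇔; Equivalence; Inverse)
open import Function.Definitions using (Injective)
open import Level using (0ℓ)
open import Relation.Binary.Construct.Closure.ReflexiveTransitive
  using (Star; ε; _◅_; _◅◅_; reverse; gmap)
open import Relation.Binary.Core using (Rel)
open import Relation.Binary.Definitions
  using (Decidable; DecidableEquality; Symmetric; Transitive; Irreflexive; tri<; tri≈; tri>)
open import Relation.Binary.PropositionalEquality
  using (_≡_; _≢_; refl; sym; trans; cong; cong₂; subst; subst₂; setoid)
open import Relation.Nullary using (¬_; Dec; yes; no; contradiction)
open import Relation.Nullary.Decidable
  using (does; does-⇔; dec-false; _×-dec_; _⊎-dec_; ¬?; map′; decidable-stable)
open import Relation.Unary as U using (Pred)

private
  variable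
    n : ℕ

-- Graphs from decidable relations

module _ (R : Rel (Fin n) 0ℓ) (R? : Decidable R)
         (R-sym : Symmetric R) (R-irrefl : Irreflexive _≡_ R) where

  fromRelation : Graph n
  fromRelation = record
    { adj        = λ u v → does (R? u v)
    ; adj-sym    = λ u v → does-⇔ (mk⇔ R-sym R-sym) (R? u v) (R? v u)
    ; adj-irrefl = λ v → dec-false (R? v v) (R-irrefl refl)
    }

  fromRelation-Adj : ∀ u v → Adj fromRelation u v ⇔ R u v
  fromRelation-Adj u v with R? u v
  ... | yes uv = mk⇔ (λ _ → uv) _
  ... | no ¬uv = mk⇔ (λ ()) ¬uv

module _ (G : Graph n) where

  symmetric : Symmetric (Adj G)
  symmetric {u} {v} = subst T (adj-sym G u v)

  irreflexive : Irreflexive _≡_ (Adj G)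
  irreflexive {u} refl = subst T (adj-irrefl G u)

  Adj? : Decidable (Adj G)
  Adj? u v = T? (adj G u v)

  complement-Adj : ∀ u v → Adj (complement G) u v ⇔ (u ≢ v × ¬ Adj G u v)
  complement-Adj u v with u ≟ v | adj G u v
  ... | yes u≡v | _     = mk⇔ (λ ()) (λ (u≢v , _) → u≢v u≡v)
  ... | no u≢v  | true  = mk⇔ (λ ()) (λ (_ , f) → f _)
  ... | no u≢v  | false = mk⇔ (λ _ → u≢v , λ ()) _

fromℤ-≤-+1 : ∀ a b → fromℤ (+ a) ℚ.≤ fromℤ (+ b) ℚ.+ 1ℚ ⇔ a ≤ suc b
fromℤ-≤-+1 a b = mk⇔ to from
  where
  sum≃ : ℚ.toℚᵘ (fromℤ (+ b) ℚ.+ 1ℚ) ℚᵘ.≃ mkℚᵘ (+ suc b) 0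
  sum≃ = ℚᵘ.≃-trans (ℚ.toℚᵘ-homo-+ (fromℤ (+ b)) 1ℚ)
    (ℚᵘ.*≡* (cong (λ k → k ℤ.* + 1)
      (trans (cong (ℤ._+ + 1) (ℤ.*-identityʳ (+ b))) (cong +_ (+-comm b 1)))))

  to : fromℤ (+ a) ℚ.≤ fromℤ (+ b) ℚ.+ 1ℚ → a ≤ suc b
  to le with ℚᵘ.≤-respʳ-≃ sum≃ (ℚ.toℚᵘ-mono-≤ le)
  ... | ℚᵘ.*≤* q = ℤ.drop‿+≤+ (subst₂ ℤ._≤_ (ℤ.*-identityʳ (+ a)) (ℤ.*-identityʳ (+ suc b)) q)

  from : a ≤ suc b → fromℤ (+ a) ℚ.≤ fromℤ (+ b) ℚ.+ 1ℚ
  from le = ℚ.toℚᵘ-cancel-≤ (ℚᵘ.≤-respʳ-≃ (ℚᵘ.≃-sym sum≃)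
    (ℚᵘ.*≤* (ℤ.*-monoʳ-≤-nonNeg (+ 1) (ℤ.+≤+ le))))

fromℤ-mono-≤ : ∀ {a b} → a ≤ b → fromℤ (+ a) ℚ.≤ fromℤ (+ b)
fromℤ-mono-≤ le = ℚ.*≤* (ℤ.*-monoʳ-≤-nonNeg (+ 1) (ℤ.+≤+ le))

Near : (Fin n → ℕ) → Rel (Fin n) 0ℓ
Near level u v = level u ≤ suc (level v) × level v ≤ suc (level u)

-- With `level v` as left endpoint, two closed unit intervals meet exactly when their integer
-- endpoints differ by at most one.
near-unitInterval : (level : Fin n → ℕ) →
  ∃[ K ] UnitInterval K × (∀ u v → Adj K u v ⇔ (u ≢ v × Near level u v))
near-unitInterval {n} level = K , (left , λ u v u≢v → mk⇔ (to u v) (from u v u≢v)) , K-Adj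
  where
  R : Rel (Fin n) 0ℓ
  R u v = u ≢ v × Near level u v

  R? : Decidable R
  R? u v = ¬? (u ≟ v) ×-dec ((level u ≤? suc (level v)) ×-dec (level v ≤? suc (level u)))

  R-sym : Symmetric R
  R-sym (u≢v , near) = u≢v ∘ sym , swap near

  R-irrefl : Irreflexive _≡_ R
  R-irrefl u≡v (u≢v , _) = u≢v u≡v

  K = fromRelation R R? R-sym R-irrefl

  K-Adj : ∀ u v → Adj K u v ⇔ R u v
  K-Adj = fromRelation-Adj R R? R-sym R-irrefl

  left : Fin n → ℚ
  left v = fromℤ (+ level v)

  to : ∀ u v → Adj K u v → ∃[ p ] p ∈[ left u ,+1] × p ∈[ left v ,+1]
  to u v uv with Equivalence.to (K-Adj u v) uv | ≤-total (level u) (level v)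
  ... | _ , _ , v≤ | inj₁ u≤v = left v ,
    (fromℤ-mono-≤ u≤v , Equivalence.from (fromℤ-≤-+1 _ _) v≤) ,
    (ℚ.≤-refl , Equivalence.from (fromℤ-≤-+1 _ _) (n≤1+n _))
  ... | _ , u≤ , _ | inj₂ v≤u = left u ,
    (ℚ.≤-refl , Equivalence.from (fromℤ-≤-+1 _ _) (n≤1+n _)) ,
    (fromℤ-mono-≤ v≤u , Equivalence.from (fromℤ-≤-+1 _ _) u≤)

  from : ∀ u v → u ≢ v → ∃[ p ] p ∈[ left u ,+1] × p ∈[ left v ,+1] → Adj K u v
  from u v u≢v (p , (u≤p , p≤u) , (v≤p , p≤v)) = Equivalence.from (K-Adj u v)
    ( u≢v , Equivalence.to (fromℤ-≤-+1 _ _) (ℚ.≤-trans u≤p p≤v)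
    , Equivalence.to (fromℤ-≤-+1 _ _) (ℚ.≤-trans v≤p p≤u))

-- The complement is taken of the bipartite graph of all non-edges of `G` between the two sides, so
-- exactly these pairs are removed and no edge of `G` is lost.
separated-coBipartite : (G : Graph n) (side : Fin n → Fin 2) →
  ∃[ K ] CoBipartite K ×
    (∀ u v → Adj K u v ⇔ (u ≢ v × ¬ (side u ≢ side v × ¬ Adj G u v)))
separated-coBipartite {n} G side =
  complement B , (B , (Inverse.to 2↔Bool ∘ side , bip) , λ _ _ → refl) , λ u v → mk⇔
    (λ uv → let u≢v , ¬B = Equivalence.to (complement-Adj B u v) uv in u≢v , ¬B ∘ Equivalence.from (B-Adj u v))
    (λ (u≢v , ¬R) → Equivalence.from (complement-Adj B u v) (u≢v , ¬R ∘ Equivalence.to (B-Adj u v)))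
  where
  R : Rel (Fin n) 0ℓ
  R u v = side u ≢ side v × ¬ Adj G u v

  R? : Decidable R
  R? u v = ¬? (side u ≟ side v) ×-dec ¬? (Adj? G u v)

  R-sym : Symmetric R
  R-sym (s , ¬uv) = s ∘ sym , ¬uv ∘ symmetric G

  R-irrefl : Irreflexive _≡_ R
  R-irrefl refl (s , _) = s refl

  B = fromRelation R R? R-sym R-irrefl

  B-Adj : ∀ u v → Adj B u v ⇔ R u v
  B-Adj = fromRelation-Adj R R? R-sym R-irrefl

  bip : ∀ u v → Adj B u v → Inverse.to 2↔Bool (side u) ≢ Inverse.to 2↔Bool (side v)
  bip u v uv eq = proj₁ (Equivalence.to (B-Adj u v) uv)
    (trans (sym (Inverse.strictlyInverseʳ 2↔Bool _))
      (trans (cong (Inverse.from 2↔Bool) eq) (Inverse.strictlyInverseʳ 2↔Bool _)))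

funToFin-cong : ∀ {m k} {f g : Fin k → Fin m} → (∀ i → f i ≡ g i) → funToFin f ≡ funToFin g
funToFin-cong {k = zero}  eq = refl
funToFin-cong {k = suc k} eq = cong₂ combine (eq zero) (funToFin-cong (eq ∘ suc))

-- Assembling the six graphs

Decomposition : Graph n → Set
Decomposition {n} G =
  ∃[ G₁ ] ∃[ G₂ ] ∃[ G₃ ] ∃[ G₄ ] ∃[ G₅ ] ∃[ G₆ ]
    ( CoBipartite G₁ × CoBipartite G₂ × CoBipartite G₃ × CoBipartite G₄
    × UnitInterval G₅
    × Chordal G₆
    × IsIntersection G (G₁ ∷ G₂ ∷ G₃ ∷ G₄ ∷ G₅ ∷ G₆ ∷ []) )

-- A non-edge of `G` that survives in `H` and in the level graph has two different colours; a bit in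
-- which they differ yields the co-bipartite graph that removes it.
decompose : (G H : Graph n) (level : Fin n → ℕ) (colour : Fin n → Fin 16) →
  (∀ u v → Adj G u v → level v ≤ suc (level u)) →
  Chordal H → (∀ u v → Adj G u v → Adj H u v) →
  (∀ u v → Adj H u v → Near level u v → colour u ≢ colour v) →
  Decomposition G
decompose {n} G H level colour layered chordal G⊆H proper =
    proj₁ (K 0F) , proj₁ (K 1F) , proj₁ (K 2F) , proj₁ (K 3F)
  , proj₁ I , H , proj₁ (proj₂ (K 0F)) , proj₁ (proj₂ (K 1F))
  , proj₁ (proj₂ (K 2F)) , proj₁ (proj₂ (K 3F))
  , proj₁ (proj₂ I) , chordal , λ u v → mk⇔ (to u v) (from u v)
  where
  -- As 16 is the fourth power of 2, a colour is a string of four binary digits.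
  bit : Fin 4 → Fin n → Fin 2
  bit i v = finToFun {2} {4} (colour v) i

  K = λ i → separated-coBipartite G (bit i)
  I = near-unitInterval level

  inK : ∀ i u v → Adj G u v → Adj (proj₁ (K i)) u v
  inK i u v uv = Equivalence.from (proj₂ (proj₂ (K i)) u v)
    ((λ eq → irreflexive G eq uv) , λ (_ , ¬uv) → ¬uv uv)

  family : Fin 6 → Graph n
  family = proj₁ (K 0F) ∷ proj₁ (K 1F) ∷ proj₁ (K 2F)
    ∷ proj₁ (K 3F) ∷ proj₁ I ∷ H ∷ []

  to : ∀ u v → Adj G u v → ∀ i → Adj (family i) u v
  to u v uv 0F = inK 0F u v uv
  to u v uv 1F = inK 1F u v uv
  to u v uv 2F = inK 2F u v uv
  to u v uv 3F = inK 3F u v uv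
  to u v uv 4F = Equivalence.from (proj₂ (proj₂ I) u v)
    ((λ eq → irreflexive G eq uv) , layered v u (symmetric G uv) , layered u v uv)
  to u v uv 5F = G⊆H u v uv

  from : ∀ u v → (∀ i → Adj (family i) u v) → Adj G u v
  from u v all = decidable-stable (Adj? G u v) λ ¬uv →
    let same : ∀ i → Adj (proj₁ (K i)) u v → bit i u ≡ bit i v
        same i uv = decidable-stable (bit i u ≟ bit i v) λ ≢ →
          proj₂ (Equivalence.to (proj₂ (proj₂ (K i)) u v) uv) (≢ , ¬uv)
        bits : ∀ i → bit i u ≡ bit i v
        bits = λ where
          0F → same 0F (all 0F)
          1F → same 1F (all 1F)
          2F → same 2F (all 2F)
          3F → same 3F (all 3F)
    in proper u v (all 5F)
         (proj₂ (Equivalence.to (proj₂ (proj₂ I) u v) (all 4F)))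
         (trans (sym (funToFin-finToFin {4} {2} (colour u)))
           (trans (funToFin-cong bits) (funToFin-finToFin {4} {2} (colour v))))

-- Finite combinatorics

least : {P : Pred ℕ 0ℓ} → U.Decidable P → ∀ k → P k → ∃[ l ] P l × (∀ j → P j → l ≤ j)
least P? k pk with P? 0
... | yes p0 = 0 , p0 , λ _ _ → z≤n
least P? zero    pk | no ¬p0 = contradiction pk ¬p0
least P? (suc k) pk | no ¬p0 with least (P? ∘ suc) k pk
... | l , pl , min = suc l , pl , λ where
  zero    p0 → contradiction p0 ¬p0
  (suc j) pj → s≤s (min j pj)

argmax : ∀ {m} (f : Fin (suc m) → ℕ) → ∃[ i ] (∀ j → f j ≤ f i)
argmax {zero}  f = zero , λ where zero → ≤-refl
argmax {suc m} f with argmax (f ∘ suc)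
... | i , max with ≤-total (f zero) (f (suc i))
...   | inj₁ le = suc i , λ where
  zero    → le
  (suc j) → max j
...   | inj₂ ge = zero , λ where
  zero    → ≤-refl
  (suc j) → ≤-trans (max j) ge

strictBound : (f : Fin n → ℕ) → ∃[ b ] (∀ i → f i < b)
strictBound {zero}  f = 0 , λ ()
strictBound {suc n} f with argmax f
... | i , max = suc (f i) , s≤s ∘ max

injective⇒surjective : ∀ {m} {f : Fin m → Fin m} → Injective _≡_ _≡_ f → ∀ y → ∃[ x ] f x ≡ y
injective⇒surjective {suc m} {f} inj y = decidable-stable (any? λ x → f x ≟ y) λ ∄ →
  let missed : ∀ x → y ≢ f x
      missed x eq = ∄ (x , sym eq)
  in contradiction (injective⇒≤ {f = λ x → punchOut (missed x)}
      (λ {a} {b} eq → inj (punchOut-injective (missed a) (missed b) eq)))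
    (<⇒≱ ≤-refl)

⊎-injective⇒surjective : ∀ {a b c} → a + b ≡ c → {f : Fin a ⊎ Fin b → Fin c} →
  Injective _≡_ _≡_ f → ∀ y → ∃[ x ] f x ≡ y
⊎-injective⇒surjective {a} refl {f} inj y =
  let x , eq = injective⇒surjective {f = f ∘ splitAt a} (splitAt-injective ∘ inj) y
  in splitAt a x , eq
  where
  splitAt-injective : Injective _≡_ _≡_ (splitAt a)
  splitAt-injective {x} {y} eq =
    trans (sym (join-splitAt a _ x)) (trans (cong (join a _) eq) (join-splitAt a _ y))

-- These conditions force `level` to be the distance from `r`. They are used for the vertices of `G`
-- and again for its faces.
record Layering {m} (E : Rel (Fin m) 0ℓ) (r : Fin m) : Set where
  field
    level      : Fin m → ℕ
    level-root : level r ≡ 0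
    level-step : ∀ {u v} → E u v → level v ≤ suc (level u)
    upward     : ∀ v → v ≢ r → ∃[ u ] E u v × level v ≡ suc (level u)

breadthFirst : ∀ {m} {E : Rel (Fin m) 0ℓ} → Decidable E → (r : Fin m) →
               (∀ v → Star E r v) → Layering E r
breadthFirst {m} {E} E? r conn = record
  { level = level ; level-root = n≤0⇒n≡0 (minimal r 0 refl) ; level-step = step ; upward = up }
  where
  Reach : ℕ → Fin m → Set
  Reach zero    v = r ≡ v
  Reach (suc k) v = ∃[ u ] Reach k u × E u v

  Reach? : ∀ k → U.Decidable (Reach k)
  Reach? zero    v = r ≟ v
  Reach? (suc k) v = any? λ u → Reach? k u ×-dec E? u v

  extend : ∀ {k u v} → Reach k u → Star E u v → ∃[ l ] Reach l v
  extend p ε        = _ , p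
  extend p (e ◅ es) = extend (_ , p , e) es

  shortest : ∀ v → ∃[ l ] Reach l v × (∀ j → Reach j v → l ≤ j)
  shortest v with extend {0} refl (conn v)
  ... | k , p = least (λ j → Reach? j v) k p

  level : Fin m → ℕ
  level v = proj₁ (shortest v)

  reach : ∀ v → Reach (level v) v
  reach v = proj₁ (proj₂ (shortest v))

  minimal : ∀ v j → Reach j v → level v ≤ j
  minimal v = proj₂ (proj₂ (shortest v))

  step : ∀ {u v} → E u v → level v ≤ suc (level u)
  step {u} {v} e = minimal v _ (u , reach u , e)

  up : ∀ v → v ≢ r → ∃[ u ] E u v × level v ≡ suc (level u)
  up v v≢r with level v in eq | reach v
  ... | zero  | r≡v = contradiction (sym r≡v) v≢r
  ... | suc k | u , p , e = u , e ,
    cong suc (≤-antisym (≤-pred (subst (_≤ _) eq (step e))) (minimal u k p))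

module Cyclic {m : ℕ} (3≤m : 3 ≤ m) where

  -- Successor modulo `m + 1`, free of modular arithmetic. On a cycle of at least four vertices it
  -- has no closed walk of length one, two or three.
  Next : Rel ℕ 0ℓ
  Next a b = (b ≡ suc a) ⊎ (b ≡ 0 × a ≡ m)

  next-toℕ : ∀ {i j : Fin (suc m)} → j ≡ suc (toℕ i) mod suc m → Next (toℕ i) (toℕ j)
  next-toℕ {i} refl with m≤n⇒m<n∨m≡n (≤-pred (toℕ<n i))
  ... | inj₁ i<m  = inj₁ (trans (toℕ-fromℕ< _) (m<n⇒m%n≡m (s≤s i<m)))
  ... | inj₂ i≡m  = inj₂ (trans (toℕ-fromℕ< _)
                     (trans (cong (λ k → suc k % suc m) i≡m) (n%n≡0 (suc m))) , i≡m)

  predecessor : ∀ (i : Fin (suc m)) → Σ[ j ∈ Fin (suc m) ] i ≡ suc (toℕ j) mod suc m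
  predecessor zero    = fromℕ m , toℕ-injective (sym (trans (toℕ-fromℕ< _)
    (trans (cong (λ k → suc k % suc m) (toℕ-fromℕ m)) (n%n≡0 (suc m)))))
  predecessor (suc i) = inject₁ i , toℕ-injective (sym (trans (toℕ-fromℕ< _)
    (trans (cong (λ k → suc k % suc m) (toℕ-inject₁ i)) (m<n⇒m%n≡m (s≤s (toℕ<n i))))))

  Next-functional : ∀ {a b c} → Next a b → Next a c → b ≤ m → c ≤ m → b ≡ c
  Next-functional (inj₁ refl)       (inj₁ refl)       _  _  = refl
  Next-functional (inj₁ refl)       (inj₂ (_ , refl)) le _  = contradiction le (<⇒≱ ≤-refl)
  Next-functional (inj₂ (_ , refl)) (inj₁ refl)       _  le = contradiction le (<⇒≱ ≤-refl)
  Next-functional (inj₂ (refl , _)) (inj₂ (refl , _)) _  _  = refl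

  private
    short : ∀ {l} → l ≤ 2 → m ≢ l
    short l≤2 refl = contradiction (≤-trans 3≤m l≤2) λ { (s≤s (s≤s ())) }

    m≢0 : m ≢ 0
    m≢0 = short z≤n

    m≢1 : m ≢ 1
    m≢1 = short (s≤s z≤n)

    m≢2 : m ≢ 2
    m≢2 = short (s≤s (s≤s z≤n))

  ¬1-cycle : ∀ {a} → ¬ Next a a
  ¬1-cycle (inj₂ (refl , q)) = m≢0 (sym q)

  ¬2-cycle : ∀ {a b} → Next a b → Next b a → ⊥
  ¬2-cycle (inj₁ refl)       (inj₂ (refl , q)) = m≢1 (sym q)
  ¬2-cycle (inj₂ (refl , q)) (inj₁ refl)       = m≢1 (sym q)
  ¬2-cycle (inj₂ (refl , p)) (inj₂ (_ , q))    = m≢0 (sym q)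

  ¬3-cycle : ∀ {a b c} → Next a b → Next b c → Next c a → ⊥
  ¬3-cycle (inj₁ refl)       (inj₁ refl)       (inj₂ (refl , q)) = m≢2 (sym q)
  ¬3-cycle (inj₁ refl)       (inj₂ (refl , p)) (inj₁ refl)       = m≢2 (sym p)
  ¬3-cycle (inj₂ (refl , p)) (inj₁ refl)       (inj₁ refl)       = m≢2 (sym p)
  ¬3-cycle (inj₁ refl)       (inj₂ (refl , p)) (inj₂ (q , r))    = m≢0 (sym r)
  ¬3-cycle (inj₂ (refl , p)) (inj₁ refl)       (inj₂ (q , r))    = m≢1 (sym r)
  ¬3-cycle (inj₂ (refl , p)) (inj₂ (refl , q)) _                 = m≢0 (sym q)

-- On an induced cycle, the two neighbours of a vertex of maximal rank would
-- have to be adjacent.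
elimination⇒chordal : (H : Graph n) (rank : Fin n → ℕ) →
  (∀ {u v w} → Adj H v u → Adj H v w → rank u ≤ rank v → rank w ≤ rank v → u ≢ w → Adj H u w) →
  Chordal H
elimination⇒chordal H rank fill k (c , c-inj , c-adj) with argmax (rank ∘ c)
... | i , max with Cyclic.predecessor {3 + k} (s≤s (s≤s (s≤s z≤n))) i
...   | j , j→i = absurd (Equivalence.to (c-adj j l)
          (fill (Equivalence.from (c-adj i j) (inj₂ j→i)) (Equivalence.from (c-adj i l) (inj₁ refl))
            (max j) (max l) (λ eq → ¬2-cycle next-ji (subst (Next (toℕ i)) (cong toℕ (sym (c-inj eq))) next-il))))
  where
  open Cyclic {3 + k} (s≤s (s≤s (s≤s z≤n)))

  l : Fin (4 + k)
  l = suc (toℕ i) mod (4 + k)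

  next-ji : Next (toℕ j) (toℕ i)
  next-ji = next-toℕ j→i

  next-il : Next (toℕ i) (toℕ l)
  next-il = next-toℕ {i} refl

  absurd : Consecutive j l → ⊥
  absurd (inj₁ j→l) = ¬1-cycle (subst (Next (toℕ i))
    (Next-functional (next-toℕ j→l) next-ji (≤-pred (toℕ<n l)) (≤-pred (toℕ<n i))) next-il)
  absurd (inj₂ l→j) = ¬3-cycle next-ji next-il (next-toℕ l→j)

-- If every colour occurred, their positions in `xs` would inject `q` colours into fewer than `q`
-- places.
fresh : ∀ {q} (xs : List (Fin q)) → length xs < q → ∃[ c ] c ∉ xs
fresh {q} xs short with any? (λ c → ¬? (_∈?_ _≟_ c xs))
... | yes c∉ = c∉
... | no ∄  = contradiction (injective⇒≤ {f = λ c → index (all c)}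
                (λ {c} {d} eq → Membership.index-injective (setoid (Fin q)) (all c) (all d) eq)) (<⇒≱ short)
  where
  all : ∀ c → c ∈ xs
  all c = decidable-stable (_∈?_ _≟_ c xs) λ ∉ → ∄ (c , ∉)

-- Vertices are coloured by increasing key; the list `earlier v` is too short for its members to use
-- up all colours.
greedyColouring : ∀ {q} (Conflict : Rel (Fin n) 0ℓ) (key : Fin n → ℕ) → Injective _≡_ _≡_ key →
  (earlier : Fin n → List (Fin n)) → (∀ v → length (earlier v) < suc q) →
  (∀ {u v} → Conflict u v → key u < key v → u ∈ earlier v) →
  Σ[ colour ∈ (Fin n → Fin (suc q)) ]
    (∀ {u v} → Conflict u v → key u < key v → colour u ≢ colour v)
greedyColouring {n} {q} Conflict key key-inj earlier short complete =
  let b , key<b = strictBound key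
      colour , proper = go b
  in colour , λ {u} {v} uv u<v → proper uv u<v (key<b v)
  where
  -- Invariant: the colouring is proper on keys below `k`. Keys being distinct, each stage recolours
  -- at most one vertex.
  go : ∀ k → Σ[ colour ∈ (Fin n → Fin (suc q)) ]
    (∀ {u v} → Conflict u v → key u < key v → key v < k → colour u ≢ colour v)
  go zero    = (λ _ → zero) , λ _ _ ()
  go (suc k) with go k | any? (λ x → key x ℕ.≟ k)
  ... | colour , proper | no ∄ = colour , λ uv u<v v≤k →
    proper uv u<v (≤∧≢⇒< (≤-pred v≤k) λ eq → ∄ (_ , eq))
  ... | colour , proper | yes (x , refl)
    with fresh (map colour (earlier x)) (subst (_< suc q) (sym (length-map colour (earlier x))) (short x))
  ...   | c , c∉ = recolour , proper′
    where
    recolour : Fin n → Fin (suc q)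
    recolour v with v ≟ x
    ... | yes _ = c
    ... | no _  = colour v

    proper′ : ∀ {u v} → Conflict u v → key u < key v → key v < suc (key x) → recolour u ≢ recolour v
    proper′ {u} {v} uv u<v v≤x with u ≟ x | v ≟ x
    ... | yes refl | _        = contradiction (≤-pred v≤x) (<⇒≱ u<v)
    ... | no _     | yes refl = λ eq → c∉ (subst (_∈ _) eq (∈-map⁺ colour (complete uv u<v)))
    ... | no _     | no v≢x   = proper uv u<v (≤∧≢⇒< (≤-pred v≤x) (v≢x ∘ key-inj))

-- Darts and spanning trees

module _ {G : Graph n} where

  rev : Dart G → Dart G
  rev (dart u v uv) = dart v u (symmetric G uv)

  dart-≡ : ∀ {d e : Dart G} → tail d ≡ tail e → head d ≡ head e → d ≡ e
  dart-≡ {dart u v uv} refl refl = cong (dart u v) (T-irrelevant uv _)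

  rev-involutive : ∀ d → rev (rev d) ≡ d
  rev-involutive d = dart-≡ refl refl

  tail≢head : (d : Dart G) → tail d ≢ head d
  tail≢head d eq = irreflexive G eq (adjacent d)

  infix 4 _≟ᴰ_

  _≟ᴰ_ : DecidableEquality (Dart G)
  d ≟ᴰ e with tail d ≟ tail e | head d ≟ head e
  ... | yes p | yes q = yes (dart-≡ p q)
  ... | no ¬p | _     = no (¬p ∘ cong tail)
  ... | yes _ | no ¬q = no (¬q ∘ cong head)

  anyDart? : {P : Pred (Dart G) 0ℓ} → U.Decidable P → Dec (∃[ d ] P d)
  anyDart? {P} P? = map′ (λ (u , v , uv , p) → dart u v uv , p)
                     (λ (d , p) → tail d , head d , adjacent d , p)
                     (any? λ u → any? λ v → at u v)
    where
    at : ∀ u v → Dec (Σ[ uv ∈ Adj G u v ] P (dart u v uv))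
    at u v with Adj? G u v
    ... | no ¬uv = no (¬uv ∘ proj₁)
    ... | yes uv = map′ (uv ,_) (λ (uv′ , p) → subst P (cong (dart u v) (T-irrelevant uv′ uv)) p) (P? (dart u v uv))

  dartBound : (f : Dart G → ℕ) → ∃[ b ] (∀ d → f d < b)
  dartBound f = proj₁ outer , λ (dart u v uv) → ≤-<-trans (at-≥ u v uv)
      (<-trans (proj₂ (strictBound (at u)) v) (proj₂ outer u))
    where
    at : Fin n → Fin n → ℕ
    at u v with Adj? G u v
    ... | yes uv = f (dart u v uv)
    ... | no _   = 0

    at-≥ : ∀ u v uv → f (dart u v uv) ≤ at u v
    at-≥ u v uv with Adj? G u v
    ... | yes uv′ = ≤-reflexive (cong (f ∘ dart u v) (T-irrelevant uv uv′))
    ... | no ¬uv  = contradiction uv ¬uv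

    outer = strictBound λ u → proj₁ (strictBound (at u))

-- The root is its own parent, so iterated parents stay at the root, in accordance with truncated
-- subtraction of levels.
record SpanningTree (G : Graph n) : Set where
  field
    root         : Fin n
    level        : Fin n → ℕ
    parent       : Fin n → Fin n
    layered      : ∀ u v → Adj G u v → level v ≤ suc (level u)
    level-root   : level root ≡ 0
    parent-root  : parent root ≡ root
    parent-adj   : ∀ {v} → v ≢ root → Adj G v (parent v)
    parent-level : ∀ {v} → v ≢ root → level v ≡ suc (level (parent v))

  upDart : ∀ {v} → v ≢ root → Dart G
  upDart v≢r = dart _ _ (parent-adj v≢r)

  level≡0⇒root : ∀ {v} → level v ≡ 0 → v ≡ root
  level≡0⇒root {v} eq with v ≟ root
  ... | yes v≡r = v≡r
  ... | no v≢r with () ← trans (sym eq) (parent-level v≢r)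

  level-parent : ∀ v → level (parent v) ≡ level v ∸ 1
  level-parent v with v ≟ root
  ... | yes refl = trans (cong level parent-root) (trans level-root (sym (cong (_∸ 1) level-root)))
  ... | no v≢r   = sym (cong (_∸ 1) (parent-level v≢r))

  level-iterate : ∀ k v → level (iterate parent v k) ≡ level v ∸ k
  level-iterate zero    v = refl
  level-iterate (suc k) v = trans (level-iterate k (parent v))
    (trans (cong (_∸ k) (level-parent v)) (∸-+-assoc (level v) 1 k))

  ascend : ∀ v → iterate parent v (level v) ≡ root
  ascend v = level≡0⇒root (trans (level-iterate (level v) v) (n∸n≡0 (level v)))

  iterate-root : ∀ k → iterate parent root k ≡ root
  iterate-root zero    = refl
  iterate-root (suc k) = trans (cong (λ v → iterate parent v k) parent-root) (iterate-root k)

  TreeEdge : Dart G → Set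
  TreeEdge d = parent (tail d) ≡ head d ⊎ parent (head d) ≡ tail d

  TreeEdge? : U.Decidable TreeEdge
  TreeEdge? d = (parent (tail d) ≟ head d) ⊎-dec (parent (head d) ≟ tail d)

  TreeEdge-rev : ∀ d → TreeEdge (rev d) → TreeEdge d
  TreeEdge-rev d (inj₁ p) = inj₂ p
  TreeEdge-rev d (inj₂ p) = inj₁ p

  child≢root : ∀ (d : Dart G) → parent (head d) ≡ tail d → head d ≢ root
  child≢root d p refl = tail≢head d (trans (sym p) parent-root)

breadthFirstTree : (G : Graph n) → Fin n → Connected G → SpanningTree G
breadthFirstTree {n} G r conn = record
  { root         = r
  ; level        = level
  ; parent       = parent
  ; layered      = λ _ _ → level-step
  ; level-root   = level-root
  ; parent-root  = parent-root
  ; parent-adj   = parent-adj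
  ; parent-level = parent-level
  }
  where
  open Layering (breadthFirst (Adj? G) r (conn r))

  parent : Fin n → Fin n
  parent v with v ≟ r
  ... | yes _  = r
  ... | no v≢r = proj₁ (upward v v≢r)

  parent-root : parent r ≡ r
  parent-root with r ≟ r
  ... | yes _  = refl
  ... | no r≢r = contradiction refl r≢r

  parent-adj : ∀ {v} → v ≢ r → Adj G v (parent v)
  parent-adj {v} v≢r with v ≟ r
  ... | yes v≡r = contradiction v≡r v≢r
  ... | no v≢r  = symmetric G (proj₁ (proj₂ (upward v v≢r)))

  parent-level : ∀ {v} → v ≢ r → level v ≡ suc (level (parent v))
  parent-level {v} v≢r with v ≟ r
  ... | yes v≡r = contradiction v≡r v≢r
  ... | no v≢r  = proj₂ (proj₂ (upward v v≢r))

-- Walking around the part of the spanning tree below x visits all its darts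
-- while crossing only non-tree edges.
module Contour {G : Graph n} (R : Rotation G) (S : SpanningTree G)
  (_⊢_~_ : Fin n → Rel (Dart G) 0ℓ)
  (~-refl  : ∀ {x d} → x ⊢ d ~ d)
  (~-sym   : ∀ {x} → Symmetric (x ⊢_~_))
  (~-trans : ∀ {x} → Transitive (x ⊢_~_))
  (widen : ∀ {x d e} → x ⊢ d ~ e → SpanningTree.parent S x ⊢ d ~ e)
  (turn  : ∀ d → head d ⊢ d ~ faceStep R d)
  (cross : ∀ d → ¬ SpanningTree.TreeEdge S d → tail d ⊢ d ~ rev d) where

  open SpanningTree S

  private
    rotate : Dart G → Dart G
    rotate d = faceStep R (rev d)

    -- Rotating from d to t crosses the edge of every dart on the way; only the
    -- dart from x to its parent must not be crossed, so it has to be t.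
    towards : ∀ {x} t → tail t ≡ x → (∀ {d} → tail d ≡ x → parent x ≡ head d → d ≡ t) →
      (∀ {c} → c ≢ root → parent c ≡ x → ∀ {d e} → tail d ≡ c → tail e ≡ c → c ⊢ d ~ e) →
      ∀ {d} → tail d ≡ x → x ⊢ d ~ t
    towards {x} t t∋x unique below {d} d∋x = let k , eq = reached d d∋x in go k d d∋x eq
      where
      reached : ∀ d → tail d ≡ x → ∃[ k ] iterate (next R x) (head d) k ≡ head t
      reached d refl = cyclic R x (head d) (head t) (adjacent d)
        (subst (λ y → Adj G y (head t)) t∋x (adjacent t))

      spin : ∀ d → tail d ≡ x → d ≢ t → x ⊢ d ~ rotate d
      spin d refl d≢t with TreeEdge? d
      ... | no ¬tree      = ~-trans (cross d ¬tree) (turn (rev d))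
      ... | yes (inj₁ eq) = contradiction (unique refl eq) d≢t
      -- The edge to a child is bypassed: a turn leads to a dart at the child, `below` links that
      -- dart to `rev d`, and a second turn gives `rotate d`.
      ... | yes (inj₂ eq) = ~-trans (subst (λ y → y ⊢ d ~ rev d) eq (widen
          (~-trans (turn d) (below (child≢root d eq) eq refl refl))))
        (turn (rev d))

      go : ∀ k d → tail d ≡ x → iterate (next R x) (head d) k ≡ head t → x ⊢ d ~ t
      go k d d∋x eq with d ≟ᴰ t
      go k       d d∋x eq | yes refl = ~-refl
      go zero    d d∋x eq | no d≢t   = contradiction (dart-≡ (trans d∋x (sym t∋x)) eq) d≢t
      go (suc k) d d∋x eq | no d≢t   = ~-trans (spin d d∋x d≢t)
        (go k (rotate d) d∋x (subst (λ y → iterate (next R x) (next R y (head d)) k ≡ head t) (sym d∋x) eq))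

    -- Induction from the deepest level upwards: `fuel` bounds the number of levels left, and a
    -- child uses up one of them.
    fan-below : ∀ fuel x → proj₁ (strictBound level) ≤ level x + fuel →
      ∀ {d e} → tail d ≡ x → tail e ≡ x → x ⊢ d ~ e
    fan-below zero x le = contradiction (proj₂ (strictBound level) x)
      (≤⇒≯ (subst (proj₁ (strictBound level) ≤_) (+-identityʳ _) le))
    fan-below (suc fuel) x le {d₁} {e₁} d₁∋x e₁∋x = conclude (x ≟ root)
      where
      below : ∀ {c} → c ≢ root → parent c ≡ x → ∀ {d e} → tail d ≡ c → tail e ≡ c → c ⊢ d ~ e
      below {c} c≢r refl = fan-below fuel c (subst (proj₁ (strictBound level) ≤_)
        (trans (+-suc (level x) fuel) (cong (_+ fuel) (sym (parent-level c≢r)))) le)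

      conclude : Dec (x ≡ root) → x ⊢ d₁ ~ e₁
      -- The root has no dart to a parent, so any target will do; elsewhere both darts are linked to
      -- the dart to the parent.
      conclude (yes refl) = towards e₁ e₁∋x
        (λ { {d} refl eq → contradiction (trans (sym parent-root) eq) (tail≢head d) }) below d₁∋x
      conclude (no x≢r)   = ~-trans (towards up refl unique below d₁∋x)
                                    (~-sym (towards up refl unique below e₁∋x))
        where
        up = upDart x≢r
        unique : ∀ {d} → tail d ≡ x → parent x ≡ head d → d ≡ up
        unique tail≡ eq = dart-≡ tail≡ (sym eq)

  fan : ∀ {x d e} → tail d ≡ x → tail e ≡ x → x ⊢ d ~ e
  fan {x} = fan-below _ x (m≤n+m _ (level x))

  widen-iterate : ∀ k {x d e} → x ⊢ d ~ e → iterate parent x k ⊢ d ~ e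
  widen-iterate zero    d~e = d~e
  widen-iterate (suc k) d~e = widen-iterate k (widen d~e)

  -- The fan at `y` links `d` to the face successor of the dart entering `y` from its parent;
  -- undoing that turn gives a dart at the parent, one level nearer to `x`.
  climb : ∀ k {x y d e} → iterate parent y k ≡ x → tail d ≡ y → tail e ≡ x → x ⊢ d ~ e
  climb zero    refl d∋y e∋x = fan d∋y e∋x
  climb (suc k) {x} {y} {d} {e} eq d∋y e∋x with y ≟ root
  ... | yes refl = fan (trans d∋y (trans (sym (iterate-root (suc k))) eq)) e∋x
  ... | no y≢r   = ~-trans (subst (λ z → z ⊢ d ~ rev up) eq (widen-iterate (suc k)
                       (~-trans (fan d∋y refl) (~-sym (turn (rev up))))))
                     (climb k eq refl e∋x)
    where
    up = upDart y≢r

-- The tree of faces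

module Classes {A : Set} {_≈_ : Rel A 0ℓ} {k : ℕ} (H : HasClasses _≈_ k) where

  class : A → Fin k
  class = proj₁ H

  class-≡ : ∀ {x y} → x ≈ y → class x ≡ class y
  class-≡ = Equivalence.from (proj₂ (proj₂ H) _ _)

  class-≈ : ∀ {x y} → class x ≡ class y → x ≈ y
  class-≈ = Equivalence.to (proj₂ (proj₂ H) _ _)

  representative : Fin k → A
  representative i = proj₁ (proj₁ (proj₂ H) i)

  class-representative : ∀ i → class (representative i) ≡ i
  class-representative i = proj₂ (proj₁ (proj₂ H) i) refl

  representative-injective : ∀ {i j} → representative i ≈ representative j → i ≡ j
  representative-injective {i} {j} eq =
    trans (sym (class-representative i)) (trans (class-≡ eq) (class-representative j))

oneClass : ∀ {A : Set} {_≈_ : Rel A 0ℓ} {k} → HasClasses _≈_ k → A → (∀ x y → x ≈ y) → k ≡ 1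
oneClass {k = zero}        H x all with () ← proj₁ H x
oneClass {k = suc zero}    H x all = refl
oneClass {k = suc (suc k)} H x all
  with () ← Classes.representative-injective H {zero} {suc zero} (all _ _)

module Dual {G : Graph n} (P : PlanarEmbedding G) (conn : Connected G)
            (S : SpanningTree G) (d₀ : Dart G)
            (d₀∋root : tail d₀ ≡ SpanningTree.root S) where

  open PlanarEmbedding P public
  open SpanningTree S

  φ : Dart G → Dart G
  φ = faceStep rotation

  module V = Classes vertices
  module E = Classes edges
  module F = Classes faces

  face : Dart G → Fin #F
  face = F.class

  face-φ : ∀ d → face (φ d) ≡ face d
  face-φ d = sym (F.class-≡ (1 , refl))

  rootFace : Fin #F
  rootFace = face d₀

  -- The dual graph restricted to non-tree edges. The witness lies in the second face, which is the
  -- child face in the layering.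
  DualEdge : Rel (Fin #F) 0ℓ
  DualEdge f g = ∃[ d ] ¬ TreeEdge d × face d ≡ g × face (rev d) ≡ f

  DualEdge? : Decidable DualEdge
  DualEdge? f g = anyDart? λ d → ¬? (TreeEdge? d) ×-dec ((face d ≟ g) ×-dec (face (rev d) ≟ f))

  DualEdge-sym : Symmetric DualEdge
  DualEdge-sym (d , cotree , eq , eq′) = rev d , cotree ∘ TreeEdge-rev d , eq′ , trans (cong face (rev-involutive d)) eq

  -- Along the contour a turn stays in its face and a crossing is a dual edge, so every face is
  -- linked to that of `d₀`.
  dualConnected : ∀ f → Star DualEdge rootFace f
  dualConnected f = subst (Star DualEdge rootFace) (F.class-representative f)
      (reverse DualEdge-sym (climb (level (tail d)) {d = d} {e = d₀} (ascend (tail d)) refl d₀∋root))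
    where
    d = F.representative f

    open Contour rotation S (λ _ d e → Star DualEdge (face d) (face e))
      ε (reverse DualEdge-sym) _◅◅_ (λ p → p)
      (λ d → subst (Star DualEdge (face d)) (sym (face-φ d)) ε)
      (λ d cotree → (rev d , cotree ∘ TreeEdge-rev d , refl , cong face (rev-involutive d)) ◅ ε)

  abstract
    dualTree : Layering DualEdge rootFace
    dualTree = breadthFirst DualEdge? rootFace dualConnected

    depth : Fin #F → ℕ
    depth = Layering.level dualTree

    -- The dart crossed to reach the parent face; for rootFace any dart of it.
    base : Fin #F → Dart G
    base f with f ≟ rootFace
    ... | yes _  = d₀
    ... | no f≢r = proj₁ (proj₁ (proj₂ (Layering.upward dualTree f f≢r)))

    face-base : ∀ f → face (base f) ≡ f
    face-base f with f ≟ rootFace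
    ... | yes f≡r = sym f≡r
    ... | no f≢r  = let _ , (_ , _ , eq , _) , _ = Layering.upward dualTree f f≢r in eq

    base-cotree : ∀ {f} → f ≢ rootFace → ¬ TreeEdge (base f)
    base-cotree {f} f≢r with f ≟ rootFace
    ... | yes f≡r = contradiction f≡r f≢r
    ... | no f≢r  = let _ , (_ , cotree , _) , _ = Layering.upward dualTree f f≢r in cotree

    base-depth : ∀ {f} → f ≢ rootFace → depth f ≡ suc (depth (face (rev (base f))))
    base-depth {f} f≢r with f ≟ rootFace
    ... | yes f≡r = contradiction f≡r f≢r
    ... | no f≢r  = let _ , (_ , _ , _ , eq) , lev = Layering.upward dualTree f f≢r
                    in trans lev (cong (suc ∘ depth) (sym eq))

  private
    -- The two extra values serve the root and the root face, which have no edge to a parent; they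
    -- account for the 2 in Euler's formula.
    vertexEdge : ∀ v → Dec (v ≡ root) → Fin (suc (suc #E))
    vertexEdge v (yes _)  = zero
    vertexEdge v (no v≢r) = suc (suc (E.class (upDart v≢r)))

    faceEdge : ∀ f → Dec (f ≡ rootFace) → Fin (suc (suc #E))
    faceEdge f (yes _) = suc zero
    faceEdge f (no _)  = suc (suc (E.class (base f)))

    -- If two parent edges agree with opposite orientations, each vertex is the parent of the other,
    -- against the levels. Depths do the same for faces.
    vertexEdge-injective : ∀ u v u? v? → vertexEdge u u? ≡ vertexEdge v v? → u ≡ v
    vertexEdge-injective u v (yes u≡r) (yes v≡r) eq = trans u≡r (sym v≡r)
    vertexEdge-injective u v (no u≢r)  (no v≢r)  eq with E.class-≈ (suc-injective (suc-injective eq))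
    ... | inj₁ (u≡v , _) = u≡v
    ... | inj₂ (u≡pv , pu≡v) = contradiction
      (trans (parent-level u≢r) (cong (suc ∘ level) pu≡v))
      (<⇒≢ (s≤s (≤-trans (n≤1+n _) (≤-reflexive (sym (trans (parent-level v≢r) (cong (suc ∘ level) (sym u≡pv))))))))

    faceEdge-injective : ∀ f g f? g? → faceEdge f f? ≡ faceEdge g g? → f ≡ g
    faceEdge-injective f g (yes f≡r) (yes g≡r) eq = trans f≡r (sym g≡r)
    faceEdge-injective f g (no f≢r)  (no g≢r)  eq with E.class-≈ (suc-injective (suc-injective eq))
    ... | inj₁ (t , h) = trans (sym (face-base f)) (trans (cong face (dart-≡ t h)) (face-base g))
    ... | inj₂ (t , h) = contradiction
      (trans (base-depth f≢r) (cong (suc ∘ depth) (trans (cong face (dart-≡ h t)) (face-base g))))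
      (<⇒≢ (s≤s (≤-trans (n≤1+n _) (≤-reflexive (sym (trans (base-depth g≢r)
        (cong (suc ∘ depth) (trans (cong face (dart-≡ (sym t) (sym h))) (face-base f)))))))))

    tree-class : ∀ v (v≢r : v ≢ root) d → E.class (upDart v≢r) ≡ E.class d → TreeEdge d
    tree-class v v≢r d eq with E.class-≈ eq
    ... | inj₁ (t , h) = inj₁ (trans (cong parent (sym t)) h)
    ... | inj₂ (t , h) = inj₂ (trans (cong parent (sym t)) h)

    edgeOf : Fin #V ⊎ Fin #F → Fin (suc (suc #E))
    edgeOf (inj₁ i) = vertexEdge (tail (V.representative i)) (tail (V.representative i) ≟ root)
    edgeOf (inj₂ f) = faceEdge f (f ≟ rootFace)

    vertex≢face : ∀ v f v? f? → vertexEdge v v? ≢ faceEdge f f?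
    vertex≢face v f (yes _)  (yes _)  ()
    vertex≢face v f (yes _)  (no _)   ()
    vertex≢face v f (no _)   (yes _)  ()
    vertex≢face v f (no v≢r) (no f≢r) eq =
      base-cotree f≢r (tree-class v v≢r (base f) (suc-injective (suc-injective eq)))

    edgeOf-injective : Injective _≡_ _≡_ edgeOf
    edgeOf-injective {inj₁ i} {inj₁ j} eq = cong inj₁ (V.representative-injective (vertexEdge-injective _ _ _ _ eq))
    edgeOf-injective {inj₁ i} {inj₂ g} eq = contradiction eq (vertex≢face _ _ _ _)
    edgeOf-injective {inj₂ f} {inj₁ j} eq = contradiction (sym eq) (vertex≢face _ _ _ _)
    edgeOf-injective {inj₂ f} {inj₂ g} eq = cong inj₂ (faceEdge-injective _ _ _ _ eq)

    count : #V + #F ≡ suc (suc #E)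
    count = trans euler (trans (cong (λ c → #E + 2 * c)
      (oneClass components d₀ λ d e → conn (tail d) (tail e))) (+-comm #E 2))

  -- The root face has no parent; its base `d₀` only marks where its boundary is cut open.
  data IsBase (d : Dart G) : Set where
    isBase : face d ≢ rootFace → d ≡ base (face d) → IsBase d

  -- Sending a vertex to its tree edge and a face to the edge of its base dart is
  -- injective, and by Euler's formula it must then hit every edge.
  cotree⇒base : ∀ d → ¬ TreeEdge d → IsBase d ⊎ IsBase (rev d)
  cotree⇒base d cotree with ⊎-injective⇒surjective count edgeOf-injective (suc (suc (E.class d)))
  ... | inj₁ i , eq = vertexCase (tail (V.representative i) ≟ root) eq
    where
    vertexCase : ∀ {v} v? → vertexEdge v v? ≡ suc (suc (E.class d)) → IsBase d ⊎ IsBase (rev d)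
    vertexCase (no v≢r) eq = contradiction (tree-class _ v≢r d (suc-injective (suc-injective eq))) cotree
  ... | inj₂ f , eq = faceCase (f ≟ rootFace) eq
    where
    found : ∀ e → e ≡ base f → f ≢ rootFace → IsBase e
    found _ refl f≢r = isBase (f≢r ∘ trans (sym (face-base f))) (cong base (sym (face-base f)))

    faceCase : ∀ f? → faceEdge f f? ≡ suc (suc (E.class d)) → IsBase d ⊎ IsBase (rev d)
    faceCase (no f≢r) eq with E.class-≈ (suc-injective (suc-injective eq))
    ... | inj₁ (t , h) = inj₁ (found d (dart-≡ (sym t) (sym h)) f≢r)
    ... | inj₂ (t , h) = inj₂ (found (rev d) (dart-≡ (sym t) (sym h)) f≢r)

-- The tree of darts and its bags

iterate-suc : ∀ {A : Set} (f : A → A) x k → iterate f x (suc k) ≡ f (iterate f x k)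
iterate-suc f x k = trans (sym (iterate-is-fold x f (suc k))) (cong f (iterate-is-fold x f k))

module DartTree {G : Graph n} (P : PlanarEmbedding G) (conn : Connected G)
                (S : SpanningTree G) (d₀ : Dart G)
                (d₀∋root : tail d₀ ≡ SpanningTree.root S) where

  open SpanningTree S
  open Dual P conn S d₀ d₀∋root

  baseOf : Dart G → Dart G
  baseOf d = base (face d)

  baseOf-φ : ∀ d → baseOf (φ d) ≡ baseOf d
  baseOf-φ d = cong base (face-φ d)

  abstract
    -- The base lies on the orbit of `d`, being in the same face. The least count is the distance
    -- along the face once it is cut open at the base.
    firstReturn : ∀ d → ∃[ k ] iterate φ d k ≡ baseOf d × (∀ j → iterate φ d j ≡ baseOf d → k ≤ j)
    firstReturn d = let k , eq = F.class-≈ (sym (face-base (face d)))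
                    in least (λ j → iterate φ d j ≟ᴰ baseOf d) k eq

    toBase : Dart G → ℕ
    toBase d = proj₁ (firstReturn d)

    toBase-φ : ∀ d → d ≢ baseOf d → toBase (φ d) < toBase d
    toBase-φ d d≢b with firstReturn d
    ... | zero  , eq , _ = contradiction eq d≢b
    ... | suc k , eq , _ = s≤s (proj₂ (proj₂ (firstReturn (φ d))) k (trans eq (sym (baseOf-φ d))))

    M : ℕ
    M = proj₁ (dartBound toBase)

    -- The lexicographic order of depth and `toBase` in one number, as `M` exceeds every `toBase`.
    rank : Dart G → ℕ
    rank d = depth (face d) * M + toBase d

  -- The parent relation of the dart tree: within a face, φ leads to the base.
  data _↑_ (d : Dart G) : Dart G → Set where
    cross : IsBase d → d ↑ rev d
    along : d ≢ baseOf d → d ↑ φ d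

  ↑-functional : ∀ {d e f} → d ↑ e → d ↑ f → e ≡ f
  ↑-functional (cross _)            (cross _)            = refl
  ↑-functional (cross (isBase _ p)) (along ¬p)           = contradiction p ¬p
  ↑-functional (along ¬p)           (cross (isBase _ p)) = contradiction p ¬p
  ↑-functional (along _)            (along _)            = refl

  upward? : ∀ d → Dec (∃[ e ] d ↑ e)
  upward? d with d ≟ᴰ baseOf d | face d ≟ rootFace
  ... | no d≢b  | _       = yes (_ , along d≢b)
  ... | yes d≡b | no f≢r  = yes (_ , cross (isBase f≢r d≡b))
  ... | yes d≡b | yes f≡r = no λ where
    (_ , cross (isBase f≢r _)) → f≢r f≡r
    (_ , along d≢b)            → d≢b d≡b

  abstract
    ↑-rank : ∀ {d e} → d ↑ e → rank e < rank d
    ↑-rank {d} (cross (isBase f≢r d≡b)) = begin-strict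
      depth (face (rev d)) * M + toBase (rev d) <⟨ +-monoʳ-< _ (proj₂ (dartBound toBase) (rev d)) ⟩
      depth (face (rev d)) * M + M              ≡⟨ +-comm _ M ⟩
      suc (depth (face (rev d))) * M            ≡⟨ cong (λ e → suc (depth (face (rev e))) * M) d≡b ⟩
      suc (depth (face (rev (baseOf d)))) * M   ≡⟨ cong (_* M) (sym (base-depth f≢r)) ⟩
      depth (face d) * M                        ≤⟨ m≤m+n _ _ ⟩
      rank d                                    ∎
      where open ≤-Reasoning
    ↑-rank {d} (along d≢b) = subst (λ f → depth f * M + toBase (φ d) < rank d) (sym (face-φ d))
      (+-monoʳ-< (depth (face d) * M) (toBase-φ d d≢b))

  Below : Fin n → Fin n → Set
  Below x y = ∃[ k ] iterate parent y k ≡ x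

  -- Up to `level y` the exponent is determined by the levels; beyond it, `x` is the root. Thus one
  -- exponent decides `Below`.
  Below-level : ∀ {x y} → Below x y → iterate parent y (level y ∸ level x) ≡ x
  Below-level {x} {y} (k , eq) with ≤-total k (level y)
  ... | inj₁ k≤ = trans (cong (iterate parent y)
    (trans (cong (level y ∸_) (trans (cong level (sym eq)) (level-iterate k y))) (m∸[m∸n]≡n k≤))) eq
  ... | inj₂ ≤k = trans (cong (λ l → iterate parent y (level y ∸ l)) level-x)
    (trans (ascend y) (sym (level≡0⇒root level-x)))
    where
    level-x : level x ≡ 0
    level-x = trans (cong level (sym eq)) (trans (level-iterate k y) (m≤n⇒m∸n≡0 ≤k))

  Below? : Decidable Below
  Below? x y = map′ (level y ∸ level x ,_) Below-level (iterate parent y (level y ∸ level x) ≟ x)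

  Below-widen : ∀ {x y} → Below x y → Below (parent x) y
  Below-widen {y = y} (k , eq) = suc k , trans (iterate-suc parent y k) (cong parent eq)

  data InBag (x : Fin n) (d : Dart G) : Set where
    byTail : Below x (tail d) → InBag x d
    byHead : Below x (head d) → InBag x d
    byBase : Below x (head (baseOf d)) → InBag x d

  InBag? : Decidable InBag
  InBag? x d with Below? x (tail d) | Below? x (head d) | Below? x (head (baseOf d))
  ... | yes p | _     | _     = yes (byTail p)
  ... | no _  | yes p | _     = yes (byHead p)
  ... | no _  | no _  | yes p = yes (byBase p)
  ... | no ¬p | no ¬q | no ¬r = no λ where
    (byTail p) → ¬p p
    (byHead q) → ¬q q
    (byBase r) → ¬r r

  InBag-widen : ∀ {x d} → InBag x d → InBag (parent x) d
  InBag-widen (byTail p) = byTail (Below-widen p)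
  InBag-widen (byHead p) = byHead (Below-widen p)
  InBag-widen (byBase p) = byBase (Below-widen p)

  data Step (x : Fin n) (d e : Dart G) : Set where
    step : InBag x d → InBag x e → d ↑ e ⊎ e ↑ d → Step x d e

  Step-sym : ∀ {x} → Symmetric (Step x)
  Step-sym (step d∋ e∋ (inj₁ p)) = step e∋ d∋ (inj₂ p)
  Step-sym (step d∋ e∋ (inj₂ p)) = step e∋ d∋ (inj₁ p)

  Step-widen : ∀ {x d e} → Step x d e → Step (parent x) d e
  Step-widen (step d∋ e∋ p) = step (InBag-widen d∋) (InBag-widen e∋) p

  -- All darts of a face share the third corner, so the walk to the base never leaves the bags
  -- containing it.
  around : ∀ k d → toBase d ≤ k → Star (Step (head (baseOf d))) d (baseOf d)
  around k d le = go k le (d ≟ᴰ baseOf d)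
    where
    go : ∀ k → toBase d ≤ k → Dec (d ≡ baseOf d) → Star (Step (head (baseOf d))) d (baseOf d)
    go k       le (yes d≡b) = subst (Star _ d) d≡b ε
    go zero    le (no d≢b)  = contradiction (≤-trans (toBase-φ d d≢b) le) λ ()
    go (suc k) le (no d≢b)  =
      step (byBase (0 , refl)) (byBase (0 , cong head (baseOf-φ d))) (inj₁ (along d≢b))
      ◅ subst (λ b → Star (Step (head b)) (φ d) b) (baseOf-φ d)
          (around k (φ d) (≤-pred (≤-trans (toBase-φ d d≢b) le)))

  turn : ∀ d → Star (Step (head d)) d (φ d)
  turn d = turn′ (d ≟ᴰ baseOf d)
    where
    turn′ : Dec (d ≡ baseOf d) → Star (Step (head d)) d (φ d)
    turn′ (no d≢b)  = step (byHead (0 , refl)) (byTail (0 , refl)) (inj₁ (along d≢b)) ◅ ε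
    -- The face is cut open between its base and the next dart, so these are joined the long way
    -- round the face.
    turn′ (yes d≡b) = reverse Step-sym (subst (λ e → Star (Step (head e)) (φ d) e)
      (trans (baseOf-φ d) (sym d≡b)) (around _ _ ≤-refl))

  -- By `cotree⇒base` one of the two darts is the parent of the other, and `tail d` is a corner of
  -- both.
  crossing : ∀ d → ¬ TreeEdge d → Star (Step (tail d)) d (rev d)
  crossing d cotree with cotree⇒base d cotree
  ... | inj₁ b = step (byTail (0 , refl)) (byHead (0 , refl)) (inj₁ (cross b)) ◅ ε
  ... | inj₂ b = step (byTail (0 , refl)) (byHead (0 , refl))
                   (inj₂ (subst (rev d ↑_) (rev-involutive d) (cross b))) ◅ ε

  open Contour rotation S (λ x → Star (Step x)) ε (reverse Step-sym) _◅◅_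
    (gmap (λ d → d) Step-widen) turn crossing

  -- Whichever corner lies below `x`, turning, if necessary after a walk to the base, reaches a dart
  -- with that corner as tail, from which `climb` leads to `x`.
  bagConnected : ∀ {x d e} → InBag x d → tail e ≡ x → Star (Step x) d e
  bagConnected         (byTail (k , eq)) e∋x = climb k eq refl e∋x
  bagConnected {d = d} (byHead (k , eq)) e∋x =
    subst (λ x → Star (Step x) d (φ d)) eq (widen-iterate k (turn d)) ◅◅ climb k eq refl e∋x
  bagConnected {d = d} (byBase (k , eq)) e∋x =
    subst (λ x → Star (Step x) d (φ (baseOf d))) eq
      (widen-iterate k (around _ _ ≤-refl ◅◅ turn (baseOf d)))
    ◅◅ climb k eq refl e∋x

  dartAt : ∀ x → Σ[ d ∈ Dart G ] tail d ≡ x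
  dartAt x with x ≟ root
  ... | yes x≡r = d₀ , trans d₀∋root (sym x≡r)
  ... | no x≢r  = upDart x≢r , refl

  connected : ∀ {x d e} → InBag x d → InBag x e → Star (Step x) d e
  connected {x} d∋ e∋ = let a , eq = dartAt x
    in bagConnected {e = a} d∋ eq ◅◅ reverse Step-sym (bagConnected e∋ eq)

  abstract
    highest : ∀ x → ∃[ k ] (∃[ d ] InBag x d × rank d ≡ k) ×
                     (∀ j → ∃[ d ] InBag x d × rank d ≡ j → k ≤ j)
    highest x = let d , eq = dartAt x in
      least (λ k → anyDart? λ d → InBag? x d ×-dec (rank d ℕ.≟ k))
        (rank d) (d , byTail (0 , eq) , refl)

    -- The root of the subtree formed by the bags containing `x`, since ranks decrease towards
    -- parents.
    top : Fin n → Dart G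
    top x = proj₁ (proj₁ (proj₂ (highest x)))

    top-InBag : ∀ x → InBag x (top x)
    top-InBag x = proj₁ (proj₂ (proj₁ (proj₂ (highest x))))

    top-minimal : ∀ {x d} → InBag x d → rank (top x) ≤ rank d
    top-minimal {x} d∋ = subst (_≤ _) (sym (proj₂ (proj₂ (proj₁ (proj₂ (highest x))))))
      (proj₂ (proj₂ (highest x)) _ (_ , d∋ , refl))

  -- If the parent of d left the bags containing x, a path inside these bags
  -- could never leave the part of the dart tree below d, which misses top x.
  ascending : ∀ {x d} → InBag x d → d ≢ top x → ∃[ e ] d ↑ e × InBag x e
  ascending {x} {d} d∋ d≢top = decidable-stable exit? λ stuck →
      outside (trapped stuck ε (connected d∋ (top-InBag x)))
    where
    exit? : Dec (∃[ e ] d ↑ e × InBag x e)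
    exit? with upward? d
    ... | no ∄ = no λ (e , up , _) → ∄ (e , up)
    ... | yes (e , up) = map′ (λ e∋ → e , up , e∋)
      (λ (_ , up′ , e∋) → subst (InBag x) (↑-functional up′ up) e∋) (InBag? x e)

    trapped : ¬ (∃[ e ] d ↑ e × InBag x e) →
      ∀ {e f} → Star _↑_ e d → Star (Step x) e f → Star _↑_ f d
    trapped stuck e↑d ε = e↑d
    trapped stuck e↑d (step _ _ (inj₂ f↑e) ◅ path) = trapped stuck (f↑e ◅ e↑d) path
    trapped stuck ε (step _ f∋ (inj₁ d↑f) ◅ path) = contradiction (_ , d↑f , f∋) stuck
    trapped stuck (e↑f ◅ f↑d) (step _ _ (inj₁ e↑f′) ◅ path) =
      trapped stuck (subst (λ g → Star _↑_ g d) (↑-functional e↑f e↑f′) f↑d) path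

    ↑*-rank : ∀ {e f} → Star _↑_ e f → rank f ≤ rank e
    ↑*-rank ε          = ≤-refl
    ↑*-rank (up ◅ ups) = ≤-trans (↑*-rank ups) (<⇒≤ (↑-rank up))

    outside : ¬ Star _↑_ (top x) d
    outside path = go path refl
      where
      go : ∀ {e} → Star _↑_ e d → e ≡ top x → ⊥
      go ε          eq   = d≢top eq
      go (up ◅ ups) refl = <⇒≱ (≤-<-trans (↑*-rank ups) (↑-rank up)) (top-minimal d∋)

  -- Climb from `d` to `top v`. The vertex `u` is not lost on the way: a parent of `top u` ranks
  -- below `top v`, so its bag cannot contain `v`.
  lowerTop-shared : ∀ {u v d} → InBag u d → InBag v d → rank (top u) ≤ rank (top v) → InBag u (top v)
  lowerTop-shared {u} {v} {d} u∋ v∋ le = go _ ≤-refl u∋ v∋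
    where
    go : ∀ k {d} → rank d ≤ k → InBag u d → InBag v d → InBag u (top v)
    go k {d} d≤k u∋ v∋ with d ≟ᴰ top v
    ... | yes refl = u∋
    ... | no d≢tv with ascending v∋ d≢tv | d ≟ᴰ top u
    ...   | e , d↑e , v∋e | yes refl = contradiction (≤-trans le (top-minimal v∋e)) (<⇒≱ (↑-rank d↑e))
    ...   | e , d↑e , v∋e | no d≢tu with ascending u∋ d≢tu
    go zero    d≤k u∋ v∋ | no _ | e , d↑e , v∋e | no _ | _ = contradiction (≤-trans (↑-rank d↑e) d≤k) λ ()
    go (suc k) d≤k u∋ v∋ | no _ | e , d↑e , v∋e | no _ | e′ , d↑e′ , u∋e′ =
      go k (≤-pred (≤-trans (↑-rank d↑e) d≤k)) (subst (InBag u) (↑-functional d↑e′ d↑e) u∋e′) v∋e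

  -- The chordal graph of shared bags and its colouring

  Share : Rel (Fin n) 0ℓ
  Share u v = u ≢ v × ∃[ d ] InBag u d × InBag v d

  Share? : Decidable Share
  Share? u v = ¬? (u ≟ v) ×-dec anyDart? λ d → InBag? u d ×-dec InBag? v d

  Share-sym : Symmetric Share
  Share-sym (u≢v , d , u∋ , v∋) = u≢v ∘ sym , d , v∋ , u∋

  Share-irrefl : Irreflexive _≡_ Share
  Share-irrefl u≡v (u≢v , _) = u≢v u≡v

  shareGraph : Graph n
  shareGraph = fromRelation Share Share? Share-sym Share-irrefl

  shareGraph-Adj : ∀ u v → Adj shareGraph u v ⇔ Share u v
  shareGraph-Adj = fromRelation-Adj Share Share? Share-sym Share-irrefl

  -- Neighbours of `v` whose tops rank no higher than `top v` all lie in the bag of `top v`, hence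
  -- are pairwise adjacent.
  shareGraph-chordal : Chordal shareGraph
  shareGraph-chordal = elimination⇒chordal shareGraph (rank ∘ top) fill
    where
    fill : ∀ {u v w} → Adj shareGraph v u → Adj shareGraph v w →
      rank (top u) ≤ rank (top v) → rank (top w) ≤ rank (top v) → u ≢ w → Adj shareGraph u w
    fill {u} {v} {w} vu vw u≤v w≤v u≢w
      with Equivalence.to (shareGraph-Adj v u) vu | Equivalence.to (shareGraph-Adj v w) vw
    ... | _ , d , v∋d , u∋d | _ , e , v∋e , w∋e = Equivalence.from (shareGraph-Adj u w)
      (u≢w , top v , lowerTop-shared u∋d v∋d u≤v , lowerTop-shared w∋e v∋e w≤v)

  ⊆-shareGraph : ∀ u v → Adj G u v → Adj shareGraph u v
  ⊆-shareGraph u v uv = Equivalence.from (shareGraph-Adj u v)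
    ((λ eq → irreflexive G eq uv) , dart u v uv , byTail (0 , refl) , byHead (0 , refl))

  -- The order by rank of the top, with ties broken by the index, which is below `n`.
  key : Fin n → ℕ
  key v = rank (top v) * n + toℕ v

  key-mono : ∀ {u v} → rank (top u) < rank (top v) → key u < key v
  key-mono {u} {v} u<v = begin-strict
    rank (top u) * n + toℕ u <⟨ +-monoʳ-< _ (toℕ<n u) ⟩
    rank (top u) * n + n     ≡⟨ +-comm _ n ⟩
    suc (rank (top u)) * n   ≤⟨ *-monoˡ-≤ n u<v ⟩
    rank (top v) * n         ≤⟨ m≤m+n _ _ ⟩
    key v                    ∎
    where open ≤-Reasoning

  key-injective : Injective _≡_ _≡_ key
  key-injective {u} {v} eq with <-cmp (rank (top u)) (rank (top v))
  ... | tri< lt _ _ = contradiction eq (<⇒≢ (key-mono lt))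
  ... | tri> _ _ gt = contradiction (sym eq) (<⇒≢ (key-mono gt))
  ... | tri≈ _ e≡ _ = toℕ-injective (+-cancelˡ-≡ (rank (top v) * n) _ _
    (trans (cong (λ r → r * n + toℕ u) (sym e≡)) eq))

  ancestor : Fin n → ℕ → Fin n
  ancestor y l = iterate parent y (level y ∸ l)

  -- A level beyond that of `y` contributes `y` itself, and for `l` zero the first two entries
  -- coincide.
  ancestorsNear : ℕ → Fin n → List (Fin n)
  ancestorsNear l y = ancestor y (l ∸ 1) List.∷ ancestor y l List.∷ ancestor y (suc l) List.∷ List.[]

  ∈-ancestorsNear : ∀ {u y l} → Below u y → level u ≤ suc l → l ≤ suc (level u) → u ∈ ancestorsNear l y
  ∈-ancestorsNear {u} {y} {l} u∋ u≤ ≤u with <-cmp (level u) l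
  ... | tri< lt _ _ = here (trans (sym (Below-level u∋)) (cong (ancestor y) (cong (_∸ 1) (≤-antisym lt ≤u))))
  ... | tri≈ _ eq _ = there (here (trans (sym (Below-level u∋)) (cong (ancestor y) eq)))
  ... | tri> _ _ gt = there (there (here (trans (sym (Below-level u∋)) (cong (ancestor y) (≤-antisym u≤ gt)))))

  earlier : Fin n → List (Fin n)
  earlier v = ancestorsNear (level v) (tail (top v))
           ++ ancestorsNear (level v) (head (top v))
           ++ ancestorsNear (level v) (head (baseOf (top v)))

  Conflict : Rel (Fin n) 0ℓ
  Conflict u v = Share u v × Near level u v

  -- With the smaller key, `top u` ranks no higher than `top v`, so `u` is an ancestor of a corner
  -- of `top v`.
  ∈-earlier : ∀ {u v} → Conflict u v → key u < key v → u ∈ earlier v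
  ∈-earlier {u} {v} ((_ , d , u∋ , v∋) , u≤ , v≤) u<v
    with lowerTop-shared u∋ v∋ (≮⇒≥ λ gt → <⇒≯ (key-mono gt) u<v)
  ... | byTail p = ∈-++⁺ˡ (∈-ancestorsNear p u≤ v≤)
  ... | byHead p = ∈-++⁺ʳ (ancestorsNear (level v) (tail (top v))) (∈-++⁺ˡ (∈-ancestorsNear p u≤ v≤))
  ... | byBase p = ∈-++⁺ʳ (ancestorsNear (level v) (tail (top v)))
                     (∈-++⁺ʳ (ancestorsNear (level v) (head (top v))) (∈-ancestorsNear p u≤ v≤))

  decomposition : Decomposition G
  decomposition = decompose G shareGraph level colour layered shareGraph-chordal ⊆-shareGraph proper
    where
    -- Three corners with three levels each list nine vertices, and 9 < 16 unfolds to 10 ≤ 10 + 6.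
    colouring = greedyColouring {q = 15} Conflict key key-injective earlier (λ _ → m≤m+n 10 6) ∈-earlier
    colour = proj₁ colouring

    proper : ∀ u v → Adj shareGraph u v → Near level u v → colour u ≢ colour v
    proper u v uv near with Equivalence.to (shareGraph-Adj u v) uv | <-cmp (key u) (key v)
    ... | share | tri< lt _ _ = proj₂ colouring (share , near) lt
    ... | share | tri> _ _ gt = proj₂ colouring (Share-sym share , swap near) gt ∘ sym
    ... | share | tri≈ _ eq _ = contradiction (key-injective eq) (proj₁ share)

-- There is no dart here to serve as `d₀`, but `G` itself is chordal: an induced cycle would need at
-- least four vertices.
subsingleton-decomposition : n ≤ 1 → (G : Graph n) → Decomposition G
subsingleton-decomposition {n} n≤1 G =
  decompose G G (λ _ → 0) (λ _ → zero) (λ _ _ _ → z≤n) chordal (λ _ _ uv → uv)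
    λ u v uv _ → contradiction uv (irreflexive G (unique u v))
  where
  chordal : Chordal G
  chordal k (c , c-inj , _) = contradiction (≤-trans (injective⇒≤ c-inj) n≤1) λ { (s≤s ()) }

  unique : ∀ u v → u ≡ v
  unique u v = toℕ-injective (trans (n<1⇒n≡0 (≤-trans (toℕ<n u) n≤1)) (sym (n<1⇒n≡0 (≤-trans (toℕ<n v) n≤1))))

theorem6 : ∀ (n : ℕ) (G : Graph n) → Connected G → Planar G →
    ∃[ G₁ ] ∃[ G₂ ] ∃[ G₃ ] ∃[ G₄ ] ∃[ G₅ ] ∃[ G₆ ]
    ( CoBipartite G₁ × CoBipartite G₂ × CoBipartite G₃ × CoBipartite G₄
    × UnitInterval G₅
    × Chordal G₆
    × IsIntersection G (G₁ ∷ G₂ ∷ G₃ ∷ G₄ ∷ G₅ ∷ G₆ ∷ []) )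
theorem6 zero          G conn P = subsingleton-decomposition z≤n G
theorem6 (suc zero)    G conn P = subsingleton-decomposition (s≤s z≤n) G
-- A path between two distinct vertices starts with an edge, which supplies `d₀` at the root.
theorem6 (suc (suc n)) G conn P with conn zero (suc zero)
... | 0v ◅ _ = DartTree.decomposition P conn (breadthFirstTree G zero conn) (dart zero _ 0v) refl
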